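{- For any integers $a,b\geq 2$, we have $\mathrm{dem}(G_{a,b})=\max\{a,b\}$, where $G_{a,b}$ denotes the grid graph of dimension $a\times b$.
   Context: The grid $G_{a,b}$ is the graph with $a$ rows and $b$ columns of vertices, i.e. the Cartesian product of a path on $a$ vertices and a path on $b$ vertices. For a finite simple connected graph $G$, $d_G(x,y)$ denotes the distance between vertices $x,y$ in $G$ (equal to $\infty$ if $x$ and $y$ are in different components), and $G-e$ is the graph obtained from $G$ by deleting the edge $e$. An edge $e$ of $G$ is monitored by a vertex $x$ if there is a vertex $y$ of $G$ with $d_G(x,y)\neq d_{G-e}(x,y)$ (equivalently, $e$ belongs to all shortest paths between $x$ and $y$ in $G$). A set $M\subseteq V(G)$ is distance-edge-monitoring if every edge of $G$ is monitored by some vertex of $M$, and $\mathrm{dem}(G)$ is the smallest size of a distance-edge-monitoring set of $G$. -}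

module Defs where

open import Data.Fin using (Fin; toℕ)
open import Data.List using (List; length)
open import Data.List.Membership.Propositional using (_∈_)
open import Data.List.Relation.Unary.Unique.Propositional using (Unique)
open import Data.Nat using (ℕ; suc; _≤_)
open import Data.Nat.Properties using (≤-antisym; 1+n≢n)
open import Data.Product using (_×_; _,_; ∃; ∃₂)
open import Data.Sum using (_⊎_; inj₁; inj₂; swap; map)
open import Data.Empty using (⊥-elim)
open import Function using (_∘_)
open import Relation.Binary.Definitions using (Irreflexive; Symmetric)
open import Relation.Binary.PropositionalEquality using (_≡_; _≢_; refl; sym; cong)
open import Relation.Nullary using (¬_)
open import Relation.Nullary.Construct.Add.Supremum using (_⁺; [_]; ⊤⁺)

record Graph (V : Set) : Set₁ where
  field
    Adj        : V → V → Set
    adj-sym    : Symmetric Adj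
    adj-irrefl : Irreflexive _≡_ Adj

open Graph public

private
  variable
    V W : Set

data Walk (G : Graph V) : V → V → ℕ → Set where
  []  : ∀ {x} → Walk G x x 0
  _∷_ : ∀ {x y z n} → Adj G x y → Walk G y z n → Walk G x z (suc n)

infixr 5 _∷_

-- IsDist G x y d means d_G(x,y) = d, where ⊤⁺ plays the role of ∞.  Distance
-- is a relation rather than a function because computing it would require
-- deciding adjacency and enumerating the vertices.
IsDist : Graph V → V → V → ℕ ⁺ → Set
IsDist G x y [ k ] = Walk G x y k × (∀ {n} → Walk G x y n → k ≤ n)
IsDist G x y ⊤⁺    = ∀ {n} → ¬ Walk G x y n

IsDist-unique : (G : Graph V) {x y : V} (d d′ : ℕ ⁺) →
                IsDist G x y d → IsDist G x y d′ → d ≡ d′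
IsDist-unique G [ _ ] [ _ ] (w , min) (w′ , min′) = cong [_] (≤-antisym (min w′) (min′ w))
IsDist-unique G [ _ ] ⊤⁺    (w , _)   none        = ⊥-elim (none w)
IsDist-unique G ⊤⁺    [ _ ] none      (w , _)     = ⊥-elim (none w)
IsDist-unique G ⊤⁺    ⊤⁺    _         _           = refl

SameEdge : V → V → V → V → Set
SameEdge u v x y = (x ≡ u × y ≡ v) ⊎ (x ≡ v × y ≡ u)

deleteEdge : Graph V → V → V → Graph V
deleteEdge G u v = record
  { Adj        = λ x y → Adj G x y × ¬ SameEdge u v x y
  ; adj-sym    = λ (e , ne) → adj-sym G e , ne ∘ flipEdge
  ; adj-irrefl = λ x≡y (e , _) → adj-irrefl G x≡y e
  }
  where
  flipEdge : ∀ {x y} → SameEdge u v y x → SameEdge u v x y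
  flipEdge (inj₁ (p , q)) = inj₂ (q , p)
  flipEdge (inj₂ (p , q)) = inj₁ (q , p)

-- The vertex x monitors the edge uv: d_G(x,y) ≠ d_{G-uv}(x,y) for some y.
Monitors : Graph V → V → V → V → Set
Monitors G x u v =
  ∃ λ y → ∃₂ λ d d′ → IsDist G x y d × IsDist (deleteEdge G u v) x y d′ × d ≢ d′

IsDEMSet : Graph V → List V → Set
IsDEMSet G M = ∀ {u v} → Adj G u v → ∃ λ x → x ∈ M × Monitors G x u v

-- IsDem G k means dem(G) = k.  A finite set of vertices is a duplicate-free
-- list, whose length is then the cardinality of the set.
IsDem : Graph V → ℕ → Set
IsDem G k =
  (∃ λ M → Unique M × IsDEMSet G M × length M ≡ k) ×
  (∀ M → Unique M → IsDEMSet G M → k ≤ length M)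

path : (n : ℕ) → Graph (Fin n)
path n = record
  { Adj        = λ i j → suc (toℕ i) ≡ toℕ j ⊎ suc (toℕ j) ≡ toℕ i
  ; adj-sym    = swap
  ; adj-irrefl = λ { refl (inj₁ p) → 1+n≢n p ; refl (inj₂ p) → 1+n≢n p }
  }

_□_ : Graph V → Graph W → Graph (V × W)
G □ H = record
  { Adj        = λ (g , h) (g′ , h′) → (g ≡ g′ × Adj H h h′) ⊎ (Adj G g g′ × h ≡ h′)
  ; adj-sym    = map (λ (p , e) → sym p , adj-sym H e) (λ (e , p) → adj-sym G e , sym p)
  ; adj-irrefl = λ { refl (inj₁ (_ , e)) → adj-irrefl H refl e
                   ; refl (inj₂ (e , _)) → adj-irrefl G refl e }
  }

grid : (a b : ℕ) → Graph (Fin a × Fin b)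
grid a b = path a □ path b

{-# OPTIONS --safe #-}

-- Geodesics of a Cartesian product of connected graphs are pairs of geodesics,
-- and may traverse the factors in either order.  So a vertex outside the fibre
-- {g} × H monitors no edge of that fibre: move inside its own fibre first.
-- Conversely a vertex of {g} × H monitors every bridge of H in its fibre,
-- because a detour through another fibre costs 2 more.  Every edge of a path
-- is a bridge, so the monitoring sets of the grid are those that meet all rows
-- and all columns; a diagonal prolonged along a side is a smallest such set.
module Submission where

open import Defs
open import Data.Bool using (Bool; true; false; not; if_then_else_)
open import Data.Empty using (⊥; ⊥-elim)
open import Data.Fin using (Fin; zero; suc; toℕ; fromℕ<; inject₁; inject≤)
open import Data.Fin.Properties
  using (_≟_; toℕ<n; toℕ-injective; toℕ-fromℕ<; toℕ-inject₁; toℕ-inject≤; injective⇒≤)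
open import Data.List using (List; length; lookup; tabulate)
open import Data.List.Properties using (length-tabulate)
open import Data.List.Membership.Propositional using (_∈_)
open import Data.List.Membership.Propositional.Properties using (∈-tabulate⁺)
open import Data.List.Relation.Unary.Any using (index)
open import Data.List.Relation.Unary.Any.Properties using (lookup-index)
open import Data.List.Relation.Unary.Unique.Propositional.Properties using (tabulate⁺)
open import Data.Nat
  using (ℕ; zero; suc; _+_; _≤_; _<_; _⊔_; z≤n; s≤s; ∣_-_∣; _<?_)
open import Data.Nat.Properties
  using (≤-refl; ≤-reflexive; ≤-trans; <-≤-trans; ≤-<-trans; <-irrefl; <-cmp; n≤1+n; m≤n+m
        ; m≤n⇒m≤1+n; m+1+n≢m; +-suc; +-comm; +-identityʳ; +-mono-≤; +-monoˡ-≤; +-monoʳ-≤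
        ; ∣n-n∣≡0; ∣-∣-comm; ∣-∣-triangle; m⊓n≤n; m≤n⇒m⊓n≡m; m≤m⊔n; m≤n⊔m; ⊔-sel; ⊔-lub)
open import Data.Product using (_×_; _,_; ∃; proj₁; proj₂; swap)
open import Data.Sum as Sum using (_⊎_; inj₁; inj₂)
open import Function using (_∘_; id)
open import Function.Definitions using (Injective)
open import Relation.Binary.Definitions using (DecidableEquality; tri<; tri≈; tri>)
open import Relation.Binary.PropositionalEquality
  using (_≡_; _≢_; refl; sym; trans; cong; subst; subst₂)
open import Relation.Nullary using (yes; no; does)
open import Relation.Nullary.Construct.Add.Supremum using ([_]; ⊤⁺; []-injective)
open import Relation.Nullary.Decidable using (dec-true; dec-false)

private
  variable
    V W : Set
    m n : ℕ

-- Walks, and monitoring under isomorphism.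

Hom : Graph V → Graph W → (V → W) → Set
Hom G H f = ∀ {x y} → Adj G x y → Adj H (f x) (f y)

mapWalk : {G : Graph V} {H : Graph W} {f : V → W} → Hom G H f →
          ∀ {x y n} → Walk G x y n → Walk H (f x) (f y) n
mapWalk hom []      = []
mapWalk hom (e ∷ w) = hom e ∷ mapWalk hom w

_++_ : {G : Graph V} → ∀ {x y z m n} → Walk G x y m → Walk G y z n → Walk G x z (m + n)
[]      ++ w′ = w′
(e ∷ w) ++ w′ = e ∷ (w ++ w′)

snoc : {G : Graph V} → ∀ {x y z n} → Walk G x y n → Adj G y z → Walk G x z (suc n)
snoc []      e′ = e′ ∷ []
snoc (e ∷ w) e′ = e ∷ snoc w e′

SameEdge-flipˡ : {u v x y : V} → SameEdge u v x y → SameEdge v u x y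
SameEdge-flipˡ = Sum.swap

SameEdge-flipʳ : {u v x y : V} → SameEdge u v x y → SameEdge u v y x
SameEdge-flipʳ = Sum.map swap swap ∘ Sum.swap

deleteEdge-⊆ : (G : Graph V) {u v : V} → Hom (deleteEdge G u v) G id
deleteEdge-⊆ G = proj₁

deleteEdge-hom : {G : Graph V} {H : Graph W} {f : V → W} {u v : V} →
                 Injective _≡_ _≡_ f → Hom G H f →
                 Hom (deleteEdge G u v) (deleteEdge H (f u) (f v)) f
deleteEdge-hom inj hom (e , ne) =
  hom e , ne ∘ Sum.map (λ (p , q) → inj p , inj q) (λ (p , q) → inj p , inj q)

-- Walks go forward along `f` and come back along `g`; `inv` returns their endpoints to `x` and `y`,
-- so neither graph has the shorter walk.
IsDist-iso : {G : Graph V} {H : Graph W} (f : V → W) (g : W → V) → (∀ x → g (f x) ≡ x) →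
             Hom G H f → Hom H G g →
             ∀ {x y} d → IsDist G x y d → IsDist H (f x) (f y) d
IsDist-iso {G = G} f g inv hf hg {x} {y} [ k ] (w , min) =
  mapWalk hf w ,
  λ w′ → min (subst₂ (λ x y → Walk G x y _) (inv x) (inv y) (mapWalk hg w′))
IsDist-iso {G = G} f g inv hf hg {x} {y} ⊤⁺ none w′ =
  none (subst₂ (λ x y → Walk G x y _) (inv x) (inv y) (mapWalk hg w′))

-- The two graphs with the edge deleted differ only in the order of the disjuncts of `SameEdge`, so
-- the identity is an isomorphism between them.
Monitors-sym : {G : Graph V} {x u v : V} → Monitors G x u v → Monitors G x v u
Monitors-sym {G = G} {u = u} {v} (y , d , d′ , D , D′ , d≢d′) =
  y , d , d′ , D ,
  IsDist-iso {G = deleteEdge G u v} {deleteEdge G v u} id id (λ _ → refl)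
    (λ (e , ne) → e , ne ∘ SameEdge-flipˡ) (λ (e , ne) → e , ne ∘ SameEdge-flipˡ) d′ D′ ,
  d≢d′

□-swap : (G : Graph V) (H : Graph W) → Hom (G □ H) (H □ G) swap
□-swap G H = Sum.swap ∘ Sum.map swap swap

swap-injective : Injective _≡_ _≡_ (swap {A = V} {B = W})
swap-injective = cong swap

Monitors-swap : {G : Graph V} {H : Graph W} {x u v : V × W} →
                Monitors (G □ H) x u v → Monitors (H □ G) (swap x) (swap u) (swap v)
Monitors-swap {G = G} {H} {u = u} {v} (y , d , d′ , D , D′ , d≢d′) =
  swap y , d , d′ ,
  IsDist-iso {G = G □ H} {H □ G} swap swap (λ _ → refl) (□-swap G H) (□-swap H G) d D ,
  IsDist-iso {G = deleteEdge (G □ H) u v} {deleteEdge (H □ G) (swap u) (swap v)}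
    swap swap (λ _ → refl)
    (deleteEdge-hom {G = G □ H} {H □ G} swap-injective (□-swap G H))
    (deleteEdge-hom {G = H □ G} {G □ H} swap-injective (□-swap H G)) d′ D′ ,
  d≢d′

-- Lipschitz functions as lower bounds for walk lengths.

Lipschitz : Graph V → (V → ℕ) → Set
Lipschitz G f = ∀ {x y} → Adj G x y → f y ≤ suc (f x)

Lipschitz-walk : {G : Graph V} {f : V → ℕ} → Lipschitz G f →
                 ∀ {x y n} → Walk G x y n → f y ≤ n + f x
Lipschitz-walk lip []      = ≤-refl
Lipschitz-walk {f = f} lip {x} (_∷_ {n = n} e w) =
  ≤-trans (Lipschitz-walk lip w)
    (≤-trans (+-monoʳ-≤ n (lip e)) (≤-reflexive (+-suc n (f x))))

-- Each step raises `f` by at most 1, so the walk is too short to climb to `f v`: it never visits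
-- `v` and cannot use the edge.
short-walk-avoids : {G : Graph V} {f : V → ℕ} {u v : V} → Lipschitz G f →
        ∀ {x y n} → Walk G x y n → n + f x < f v → Walk (deleteEdge G u v) x y n
short-walk-avoids lip [] _ = []
short-walk-avoids {G = G} {f} {u} {v} lip {x} (_∷_ {y = y} {n = n} e w) lt =
  (e , λ { (inj₁ (_ , refl)) → <-irrefl refl (≤-<-trans (m≤n+m _ n) lt′)
         ; (inj₂ (refl , _)) → <-irrefl refl (≤-<-trans (m≤n+m _ (suc n)) lt) })
  ∷ short-walk-avoids lip w lt′
  where
  lt′ : n + f y < f v
  lt′ = ≤-<-trans (≤-trans (+-monoʳ-≤ n (lip e)) (≤-reflexive (+-suc n (f x)))) lt

-- All values are finite, so this includes connectedness of `G`.
Distance : Graph V → (V → V → ℕ) → Set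
Distance G δ = ∀ x y → IsDist G x y [ δ x y ]

Distance-lipschitz : {G : Graph V} {δ : V → V → ℕ} → Distance G δ → ∀ x → Lipschitz G (δ x)
Distance-lipschitz dist x {y} {z} e = proj₂ (dist x z) (snoc (proj₁ (dist x y)) e)

Distance-refl : {G : Graph V} {δ : V → V → ℕ} → Distance G δ → ∀ x → δ x x ≤ 0
Distance-refl dist x = proj₂ (dist x x) []

-- Distances in a Cartesian product.

module _ (G : Graph V) (H : Graph W) where

  fibre : ∀ g → Hom H (G □ H) (g ,_)
  fibre g e = inj₁ (refl , e)

  -- Every step moves exactly one coordinate, so sorting the steps by factor splits the length.
  □-project : ∀ {x y n} → Walk (G □ H) x y n →
              ∃ λ k → ∃ λ l → Walk G (proj₁ x) (proj₁ y) k × Walk H (proj₂ x) (proj₂ y) l ×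
                              k + l ≡ n
  □-project [] = 0 , 0 , [] , [] , refl
  □-project (inj₁ (refl , e) ∷ w) with □-project w
  ... | k , l , w₁ , w₂ , refl = k , suc l , w₁ , e ∷ w₂ , +-suc k l
  □-project (inj₂ (e , refl) ∷ w) with □-project w
  ... | k , l , w₁ , w₂ , refl = suc k , l , e ∷ w₁ , w₂ , refl

  □-shortest : ∀ {g g′ h h′ k l} → IsDist G g g′ [ k ] → IsDist H h h′ [ l ] →
               ∀ {n} → Walk (G □ H) (g , h) (g′ , h′) n → k + l ≤ n
  □-shortest (_ , min₁) (_ , min₂) w with □-project w
  ... | _ , _ , w₁ , w₂ , refl = +-mono-≤ (min₁ w₁) (min₂ w₂)

  module _ {δ₁ : V → V → ℕ} {δ₂ : W → W → ℕ} (dist₁ : Distance G δ₁) (dist₂ : Distance H δ₂) where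

    □-distance-off-fibre : ∀ {p i u v} → p ≢ i → ∀ q y →
      IsDist (deleteEdge (G □ H) (i , u) (i , v)) (p , q) y
             [ δ₁ p (proj₁ y) + δ₂ q (proj₂ y) ]
    □-distance-off-fibre {p} {i} {u} {v} p≢i q (p′ , q′) =
      subst (Walk G□H-e (p , q) (p′ , q′)) (+-comm (δ₂ q q′) (δ₁ p p′))
        -- The `H` steps come first, while the walk is still in the fibre of `p`, away from the
        -- deleted edge.
        (mapWalk alongH (proj₁ (dist₂ q q′)) ++ mapWalk alongG (proj₁ (dist₁ p p′))) ,
      □-shortest (dist₁ p p′) (dist₂ q q′) ∘ mapWalk (deleteEdge-⊆ (G □ H))
      where
      G□H-e = deleteEdge (G □ H) (i , u) (i , v)

      alongH : Hom H G□H-e (p ,_)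
      alongH e = fibre p e , λ { (inj₁ (refl , _)) → p≢i refl ; (inj₂ (refl , _)) → p≢i refl }

      -- A step along `G` changes the first coordinate, which the deleted edge keeps fixed.
      alongG : Hom G G□H-e (_, q′)
      alongG e = inj₂ (e , refl) ,
        λ { (inj₁ (refl , refl)) → adj-irrefl G refl e
          ; (inj₂ (refl , refl)) → adj-irrefl G refl e }

    □-distance : ∀ g g′ h h′ → IsDist (G □ H) (g , h) (g′ , h′) [ δ₁ g g′ + δ₂ h h′ ]
    □-distance g g′ h h′ =
      mapWalk (λ e → inj₂ (e , refl)) (proj₁ (dist₁ g g′)) ++
      mapWalk (fibre g′) (proj₁ (dist₂ h h′)) ,
      □-shortest (dist₁ g g′) (dist₂ h h′)

    -- Off the fibre of `i`, the distance is the same sum before and after the deletion,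
    -- contradicting `d ≢ d′`.
    monitored-in-fibre : DecidableEquality V → ∀ {x i u v} →
                         Monitors (G □ H) x (i , u) (i , v) → proj₁ x ≡ i
    monitored-in-fibre _≟_ {p , q} {i} {u} {v} (y , d , d′ , D , D′ , d≢d′) with p ≟ i
    ... | yes p≡i = p≡i
    ... | no  p≢i = ⊥-elim (d≢d′ (trans
      (IsDist-unique (G □ H) d _ D (□-distance p (proj₁ y) q (proj₂ y)))
      (IsDist-unique (deleteEdge (G □ H) (i , u) (i , v)) _ d′
        (□-distance-off-fibre p≢i q y) D′)))

-- Bridges and the detour through a neighbouring fibre.

-- If moreover S separates u from v, then uv is a bridge of H.
Cut : Graph V → (V → Bool) → V → V → Set
Cut H S u v = ∀ {x y} → Adj H x y → S x ≡ S y ⊎ SameEdge u v x y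

module _ (G : Graph V) (H : Graph W) (_≟_ : DecidableEquality V)
         {δ : W → W → ℕ} (dist : Distance H δ)
         {g g′ : V} (g∼g′ : Adj G g g′)
         {h u v : W} (u∼v : Adj H u v) {S : W → Bool} (cut : Cut H S u v)
         (Sh : S h ≡ false) (Su : S u ≡ false) (Sv : S v ≡ true) where

  private
    k = δ h u
    e⁻ = deleteEdge (G □ H) (g , u) (g , v)

    -- The distance from `h` on the near side, frozen at `suc k` beyond the cut. The only edge that
    -- crosses is `uv`, where the values are `k` and `suc k`.
    level : W → ℕ
    level c = if S c then suc k else δ h c

    level-u : level u ≡ k
    level-u rewrite Su = refl

    level-v : level v ≡ suc k
    level-v rewrite Sv = refl

    level-h : level h ≤ 0
    level-h rewrite Sh = Distance-refl dist h

    level-lipschitz : Lipschitz H level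
    level-lipschitz {c} {c′} e with cut e
    ... | inj₂ (inj₁ (refl , refl)) rewrite Su | Sv = ≤-refl
    ... | inj₂ (inj₂ (refl , refl)) rewrite Su | Sv = m≤n⇒m≤1+n (n≤1+n k)
    ... | inj₁ Sc≡Sc′ rewrite Sc≡Sc′ with S c′
    ...   | true  = n≤1+n (suc k)
    ...   | false = Distance-lipschitz dist h e

    -- Beyond the cut the fibre of g can only be entered from another fibre.
    penalty : Bool → Bool → ℕ
    penalty true  s = if s then 2 else 0
    penalty false s = 1

    -- It rises from 0 at `(g , h)` to `suc k + 2` at `(g , v)`, and so certifies that no detour is
    -- shorter.
    potential : V × W → ℕ
    potential (p , c) = level c + penalty (does (p ≟ g)) (S c)

    -- Inside a fibre the penalty changes only across `uv` in the fibre of `g`, and that edge is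
    -- gone. Between fibres the level is constant and the penalty changes by at most 1.
    potential-lipschitz : Lipschitz e⁻ potential
    potential-lipschitz {p , c} {_ , c′} (inj₁ (refl , e) , ne) with p ≟ g
    ... | no _     = +-monoˡ-≤ 1 (level-lipschitz e)
    ... | yes refl with cut e
    ...   | inj₁ Sc≡Sc′ =
      subst (λ s → level c′ + penalty true (S c′) ≤ suc (level c + penalty true s))
        (sym Sc≡Sc′) (+-monoˡ-≤ (penalty true (S c′)) (level-lipschitz e))
    ...   | inj₂ (inj₁ (refl , refl)) = ⊥-elim (ne (inj₁ (refl , refl)))
    ...   | inj₂ (inj₂ (refl , refl)) = ⊥-elim (ne (inj₂ (refl , refl)))
    potential-lipschitz {p , c} {p′ , _} (inj₂ (e , refl) , ne) =
      ≤-trans (+-monoʳ-≤ (level c) pen) (≤-reflexive (+-suc (level c) _))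
      where
      pen : penalty (does (p′ ≟ g)) (S c) ≤ suc (penalty (does (p ≟ g)) (S c))
      pen with p ≟ g | p′ ≟ g
      ... | yes refl | yes refl = ⊥-elim (adj-irrefl G refl e)
      ... | yes _ | no _  = s≤s z≤n
      ... | no _  | no _  = s≤s z≤n
      ... | no _  | yes _ with S c
      ...   | true  = ≤-refl
      ...   | false = z≤n

    potential-start : potential (g , h) ≤ 0
    potential-start rewrite dec-true (g ≟ g) refl | Sh =
      subst (_≤ 0) (sym (+-identityʳ _)) (Distance-refl dist h)

    potential-end : potential (g , v) ≡ suc k + 2
    potential-end rewrite dec-true (g ≟ g) refl | Sv = refl

    vanishing-start : ∀ {x y} n → x ≤ 0 → y ≤ n + x → y ≤ n
    vanishing-start n z≤n y≤ = subst (_ ≤_) (+-identityʳ n) y≤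

    reach : IsDist (G □ H) (g , h) (g , v) [ suc k ]
    reach =
      mapWalk (fibre G H g) (snoc (proj₁ (dist h u)) u∼v) ,
      -- The `H` part of the walk must itself climb from level 0 to `suc k`.
      λ w → let (a , b , _ , w₂ , a+b≡n) = □-project G H w in
        ≤-trans
          (subst (_≤ b) level-v (vanishing-start b level-h (Lipschitz-walk level-lipschitz w₂)))
          (subst (b ≤_) a+b≡n (m≤n+m b a))

    detour : IsDist e⁻ (g , h) (g , v) [ suc k + 2 ]
    detour =
      subst (Walk e⁻ (g , h) (g , v)) (+-suc k 2)
        -- A shortest walk from `h` to `u` has length `k`, below the level of `v`, so it survives
        -- the deletion.
        (mapWalk (deleteEdge-hom {G = H} {G □ H} (cong proj₂) (fibre G H g))
           (short-walk-avoids level-lipschitz (proj₁ (dist h u)) short)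
         -- Three more steps: over to the fibre of `g′`, along its copy of `uv`, and back.
         ++ ((inj₂ (g∼g′ , refl) , off₁) ∷ (inj₁ (refl , u∼v) , off₂)
             ∷ (inj₂ (adj-sym G g∼g′ , refl) , off₂) ∷ [])) ,
      λ {n} w → subst (_≤ n) potential-end
        (vanishing-start n potential-start (Lipschitz-walk potential-lipschitz w))
      where
      short : k + level h < level v
      short = subst (k + level h <_) (sym level-v)
        (s≤s (≤-trans (+-monoʳ-≤ k level-h) (≤-reflexive (+-identityʳ k))))

      g′≢g : g′ ≢ g
      g′≢g p = adj-irrefl G (sym p) g∼g′

      off₁ : ∀ {c c′} → SameEdge (g , u) (g , v) (g , c) (g′ , c′) → ⊥
      off₁ = λ { (inj₁ (_ , p)) → g′≢g (cong proj₁ p) ; (inj₂ (_ , p)) → g′≢g (cong proj₁ p) }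

      off₂ : ∀ {c x} → SameEdge (g , u) (g , v) (g′ , c) x → ⊥
      off₂ = λ { (inj₁ (p , _)) → g′≢g (cong proj₁ p) ; (inj₂ (p , _)) → g′≢g (cong proj₁ p) }

  fibre-monitors-bridge : Monitors (G □ H) (g , h) (g , u) (g , v)
  fibre-monitors-bridge =
    (g , v) , [ suc k ] , [ suc k + 2 ] , reach , detour ,
    λ eq → m+1+n≢m (suc k) (sym ([]-injective eq))

-- Distances and bridges of paths.

path-suc : Hom (path n) (path (suc n)) suc
path-suc = Sum.map (cong suc) (cong suc)

path-walk : (i j : Fin n) → Walk (path n) i j ∣ toℕ i - toℕ j ∣
path-walk zero          zero          = []
path-walk zero          (suc zero)    = inj₁ refl ∷ []
path-walk zero          (suc (suc j)) = inj₁ refl ∷ mapWalk path-suc (path-walk zero (suc j))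
path-walk (suc zero)    zero          = inj₂ refl ∷ []
path-walk (suc (suc i)) zero          = snoc (mapWalk path-suc (path-walk (suc i) zero)) (inj₂ refl)
path-walk (suc i)       (suc j)       = mapWalk path-suc (path-walk i j)

path-lipschitz : (i : Fin n) → Lipschitz (path n) (λ j → ∣ toℕ i - toℕ j ∣)
path-lipschitz i {j} {j′} e =
  ≤-trans (∣-∣-triangle (toℕ i) (toℕ j) (toℕ j′))
    (≤-reflexive (trans (cong (∣ toℕ i - toℕ j ∣ +_) (step e)) (+-comm _ 1)))
  where
  ∣n-1+n∣≡1 : ∀ n → ∣ n - suc n ∣ ≡ 1
  ∣n-1+n∣≡1 zero    = refl
  ∣n-1+n∣≡1 (suc n) = ∣n-1+n∣≡1 n

  step : ∀ {n} {j j′ : Fin n} → Adj (path n) j j′ → ∣ toℕ j - toℕ j′ ∣ ≡ 1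
  step {j = j} (inj₁ p) = subst (λ m → ∣ toℕ j - m ∣ ≡ 1) p (∣n-1+n∣≡1 (toℕ j))
  step {j = j} {j′} (inj₂ p) = trans (∣-∣-comm (toℕ j) (toℕ j′))
    (subst (λ m → ∣ toℕ j′ - m ∣ ≡ 1) p (∣n-1+n∣≡1 (toℕ j′)))

path-distance : Distance (path n) (λ i j → ∣ toℕ i - toℕ j ∣)
path-distance i j =
  path-walk i j ,
  λ {l} w → subst (∣ toℕ i - toℕ j ∣ ≤_) (trans (cong (l +_) (∣n-n∣≡0 (toℕ i))) (+-identityʳ l))
    (Lipschitz-walk (path-lipschitz i) w)

-- Provides the second fibre for the detour; here the upper bound uses that a side has at least two
-- vertices.
path-neighbour : (i : Fin (suc (suc n))) → ∃ λ j → Adj (path (suc (suc n))) i j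
path-neighbour zero    = suc zero , inj₁ refl
path-neighbour (suc i) = inject₁ i , inj₂ (cong suc (toℕ-inject₁ i))

after : Fin n → Fin n → Bool
after u c = does (toℕ u <? toℕ c)

after-irrefl : (u : Fin n) → after u u ≡ false
after-irrefl u = dec-false (toℕ u <? toℕ u) (<-irrefl refl)

after-suc : {u v : Fin n} → suc (toℕ u) ≡ toℕ v → after u v ≡ true
after-suc {u = u} {v} su≡v = dec-true (toℕ u <? toℕ v) (≤-reflexive su≡v)

-- An upward step from `x` changes `after u` only when `x` is `u`: from above `u` it stays above,
-- from below it gets no further than `u`.
path-cut : {u v : Fin n} → suc (toℕ u) ≡ toℕ v → Cut (path n) (after u) u v
path-cut {u = u} {v} su≡v = λ { (inj₁ p) → up p ; (inj₂ p) → Sum.map sym SameEdge-flipʳ (up p) }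
  where
  up : ∀ {x y} → suc (toℕ x) ≡ toℕ y → after u x ≡ after u y ⊎ SameEdge u v x y
  up {x} {y} sx≡y with <-cmp (toℕ u) (toℕ x)
  ... | tri< u<x _ _ = inj₁ (trans (dec-true (toℕ u <? toℕ x) u<x)
          (sym (dec-true (toℕ u <? toℕ y) (subst (toℕ u <_) sx≡y (m≤n⇒m≤1+n u<x)))))
  ... | tri≈ _ u≡x _ = inj₂ (inj₁ (toℕ-injective (sym u≡x) ,
          toℕ-injective (trans (sym sx≡y) (trans (cong suc (sym u≡x)) su≡v))))
  ... | tri> u≮x _ x<u = inj₁ (trans (dec-false (toℕ u <? toℕ x) u≮x)
          (sym (dec-false (toℕ u <? toℕ y)
            (λ u<y → <-irrefl refl (<-≤-trans u<y (subst (_≤ toℕ u) sx≡y x<u))))))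

fibre-monitors-path : (G : Graph V) → DecidableEquality V → ∀ {g g′} → Adj G g g′ →
                      ∀ h {u v : Fin n} → Adj (path n) u v →
                      Monitors (G □ path n) (g , h) (g , u) (g , v)
fibre-monitors-path {n = n} G _≟_ {g} g∼g′ h = orient
  where
  up : ∀ {u v} → suc (toℕ u) ≡ toℕ v → Monitors (G □ path n) (g , h) (g , u) (g , v)
  up {u} {v} su≡v with after u h in eq
  ... | false = fibre-monitors-bridge G (path n) _≟_ path-distance g∼g′ (inj₁ su≡v)
                  (path-cut su≡v) eq (after-irrefl u) (after-suc su≡v)
  -- When `h` lies beyond the edge, the near end is `v`: the edge is read backwards and the cut is
  -- complemented.
  ... | true  = Monitors-sym {G = G □ path n}
                  (fibre-monitors-bridge G (path n) _≟_ path-distance g∼g′ (inj₂ su≡v)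
                    (Sum.map (cong not) SameEdge-flipˡ ∘ path-cut su≡v)
                    (cong not eq) (cong not (after-suc su≡v)) (cong not (after-irrefl u)))

  orient : ∀ {u v} → Adj (path n) u v → Monitors (G □ path n) (g , h) (g , u) (g , v)
  orient (inj₁ p) = up p
  orient (inj₂ p) = Monitors-sym {G = G □ path n} (up p)

-- Covering sets and the prolonged diagonal.

covering-length : (M : List V) (f : V → Fin n) → (∀ i → ∃ λ x → x ∈ M × f x ≡ i) → n ≤ length M
covering-length M f cover = injective⇒≤ {f = position} λ {i} {j} eq →
  trans (sym (position-spec i)) (trans (cong (f ∘ lookup M) eq) (position-spec j))
  where
  -- `f` recovers `i` from the entry at its position, which makes `position` injective.
  position = λ i → index (proj₁ (proj₂ (cover i)))

  position-spec : ∀ i → f (lookup M (position i)) ≡ i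
  position-spec i with cover i
  ... | x , x∈M , fx≡i = trans (cong f (sym (lookup-index x∈M))) fx≡i

-- Truncation to the minimum of `toℕ i` and `n`, so that the diagonal stays at the last row or
-- column once the shorter side is exhausted.
clamp : Fin m → Fin (suc n)
clamp {n = n} i = fromℕ< (s≤s (m⊓n≤n (toℕ i) n))

toℕ-clamp : {i : Fin m} → toℕ i < suc n → toℕ (clamp {n = n} i) ≡ toℕ i
toℕ-clamp {n = n} {i} (s≤s i≤n) = trans (toℕ-fromℕ< _) (m≤n⇒m⊓n≡m i≤n)

clamp-injective : m ≡ suc n → Injective _≡_ _≡_ (clamp {m} {n})
clamp-injective {n = n} refl {i} {j} eq = toℕ-injective
  (trans (sym (toℕ-clamp (toℕ<n i))) (trans (cong toℕ eq) (toℕ-clamp (toℕ<n j))))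

clamp-inject≤ : (n<m : suc n ≤ m) (i : Fin (suc n)) → clamp (inject≤ i n<m) ≡ i
clamp-inject≤ n<m i = toℕ-injective
  (trans (toℕ-clamp (subst (_< _) (sym (toℕ-inject≤ i n<m)) (toℕ<n i))) (toℕ-inject≤ i n<m))

diagonal : ∀ m n → Fin (suc m ⊔ suc n) → Fin (suc m) × Fin (suc n)
diagonal m n i = clamp i , clamp i

-- The coordinate along the longer side is not truncated and already determines the index.
diagonal-injective : ∀ m n → Injective _≡_ _≡_ (diagonal m n)
diagonal-injective m n eq with ⊔-sel (suc m) (suc n)
... | inj₁ p = clamp-injective p (cong proj₁ eq)
... | inj₂ p = clamp-injective p (cong proj₂ eq)

theorem10 : (a b : ℕ) → 2 ≤ a → 2 ≤ b → IsDem (grid a b) (a ⊔ b)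
theorem10 (suc (suc m)) (suc (suc n)) (s≤s (s≤s _)) (s≤s (s≤s _)) =
  (M , tabulate⁺ (diagonal-injective (suc m) (suc n)) , monitoring , length-tabulate diag) ,
  λ N _ dem → ⊔-lub
    (covering-length N proj₁ λ i →
      -- The first edge of row `i` can only be monitored from row `i`, so the set meets every row.
      let (x , x∈N , mon) = dem {i , zero} {i , suc zero} (inj₁ (refl , inj₁ refl)) in
      x , x∈N , monitored-in-fibre (path a) (path b) path-distance path-distance _≟_ mon)
    (covering-length N proj₂ λ j →
      -- Likewise for columns, after exchanging the factors.
      let (x , x∈N , mon) = dem {zero , j} {suc zero , j} (inj₂ (inj₁ refl , refl)) in
      x , x∈N , monitored-in-fibre (path b) (path a) path-distance path-distance _≟_
                  (Monitors-swap {G = path a} {path b} mon))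
  where
  a = suc (suc m)
  b = suc (suc n)
  diag = diagonal (suc m) (suc n)
  M = tabulate diag

  monitoring : IsDEMSet (grid a b) M
  monitoring {i , _} (inj₁ (refl , e)) =
    -- The diagonal vertex of index `i` lies in row `i`, since clamping leaves `i` unchanged.
    diag k , ∈-tabulate⁺ {f = diag} k ,
    subst (λ r → Monitors (grid a b) (r , clamp k) _ _) (sym (clamp-inject≤ (m≤m⊔n a b) i))
      (fibre-monitors-path (path a) _≟_ (proj₂ (path-neighbour i)) (clamp k) e)
    where k = inject≤ i (m≤m⊔n a b)
  monitoring {_ , j} (inj₂ (e , refl)) =
    diag k , ∈-tabulate⁺ {f = diag} k ,
    subst (λ c → Monitors (grid a b) (clamp k , c) _ _) (sym (clamp-inject≤ (m≤n⊔m a b) j))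
      (Monitors-swap {G = path b} {path a}
        (fibre-monitors-path (path b) _≟_ (proj₂ (path-neighbour j)) (clamp k) e))
    where k = inject≤ j (m≤n⊔m a b)
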